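{- For every term $s$, every $k\in\mathbb N$ and every heap-machine state $\sigma$, if $\sigma_s\succ^k\sigma$ then $|\sigma|\le(k+1)(3k+4|s|)$.
   Context: Terms (de Bruijn): $s::=n\mid st\mid\lambda s$ with size $|n|=1+n$, $|\lambda s|=1+|s|$, $|st|=1+|s|+|t|$. Programs: lists of commands $\mathsf{ret},\mathsf{var}\,n,\mathsf{lam},\mathsf{app}$, sizes $|\mathsf{var}\,n|=1+n$, $|c|=1$ otherwise, $|P|=1+\sum_{c\in P}|c|$. Compilation: $\gamma n=[\mathsf{var}\,n]$, $\gamma(st)=\gamma s++\gamma t++[\mathsf{app}]$, $\gamma(\lambda s)=\mathsf{lam}::\gamma s++[\mathsf{ret}]$. $\varphi P:=\varphi_{0,[]}P$ with $\varphi_{0,Q}(\mathsf{ret}::P)=(Q,P)$, $\varphi_{k+1,Q}(\mathsf{ret}::P)=\varphi_{k,Q++[\mathsf{ret}]}P$, $\varphi_{k,Q}(\mathsf{lam}::P)=\varphi_{k+1,Q++[\mathsf{lam}]}P$, $\varphi_{k,Q}(c::P)=\varphi_{k,Q++[c]}P$ for $c$ a $\mathsf{var}$ or $\mathsf{app}$, undefined otherwise. Addresses are natural numbers; a closure is a pair $(P,a)$ (program, address); a heap entry is a pair $(g,b)$ (closure, address); a heap $H$ is a list of heap entries; $H[a]$ is the $a$-th entry for $1\le a\le|H|$, undefined otherwise. Lookup: if $H[a]=(g,b)$ then $H[a,0]=g$ and $H[a,n+1]=H[b,n]$; else undefined. Heap machine: states $(T,V,H)$ with $T,V$ lists of closures;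 steps $((\mathsf{var}\,n::P,a)::T,V,H)\succ((P,a)::T,g::V,H)$ if $H[a,n]=g$; $((\mathsf{lam}::P,a)::T,V,H)\succ((P',a)::T,(Q,a)::V,H)$ if $\varphi P=(Q,P')$; $((\mathsf{app}::P,a)::T,g::(Q,b)::V,H)\succ((Q,|H|+1)::(P,a)::T,V,H++[(g,b)])$; $(([],a)::T,V,H)\succ(T,V,H)$. Initial state $\sigma_s:=([(\gamma s,0)],[],[])$. Sizes: $|(P,a)|=|P|+a$ for closures, $|(g,b)|=|g|+b$ for heap entries, and the size of a state $(T,V,H)$ is the sum of the sizes of all closures in $T$ and $V$ and all entries in $H$. -}

module Defs where

open import Data.List.Base using (List; []; _∷_; _++_; [_]; length; map)
open import Data.Maybe.Base using (Maybe; just; nothing; _>>=_)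
open import Data.Nat.Base using (ℕ; zero; suc; _+_)
open import Data.Nat.ListAction using (sum)
open import Data.Product.Base using (_×_; _,_)
open import Relation.Binary.PropositionalEquality.Core using (_≡_)

infix  8 #_
infixl 7 _·_

data Term : Set where
  #_  : ℕ → Term
  _·_ : Term → Term → Term
  ƛ   : Term → Term

sizeTerm : Term → ℕ
sizeTerm (# n)   = 1 + n
sizeTerm (s · t) = 1 + sizeTerm s + sizeTerm t
sizeTerm (ƛ s)   = 1 + sizeTerm s

data Command : Set where
  ret : Command
  var : ℕ → Command
  lam : Command
  app : Command

Program : Set
Program = List Command

sizeCommand : Command → ℕ
sizeCommand ret     = 1
sizeCommand (var n) = 1 + n
sizeCommand lam     = 1
sizeCommand app     = 1

sizeProgram : Program → ℕ
sizeProgram P = 1 + sum (map sizeCommand P)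

γ : Term → Program
γ (# n)   = [ var n ]
γ (s · t) = γ s ++ γ t ++ [ app ]
γ (ƛ s)   = lam ∷ γ s ++ [ ret ]

-- φ-acc k Q P is φ_{k,Q} P: k counts the currently open lam commands and
-- Q accumulates the body read so far.
φ-acc : ℕ → Program → Program → Maybe (Program × Program)
φ-acc k       Q []          = nothing
φ-acc k       Q (lam ∷ P)   = φ-acc (suc k) (Q ++ [ lam ]) P
φ-acc k       Q (var n ∷ P) = φ-acc k (Q ++ [ var n ]) P
φ-acc k       Q (app ∷ P)   = φ-acc k (Q ++ [ app ]) P
φ-acc zero    Q (ret ∷ P)   = just (Q , P)
φ-acc (suc k) Q (ret ∷ P)   = φ-acc k (Q ++ [ ret ]) P

φ : Program → Maybe (Program × Program)
φ = φ-acc 0 []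

Address : Set
Address = ℕ

Closure : Set
Closure = Program × Address

HeapEntry : Set
HeapEntry = Closure × Address

Heap : Set
Heap = List HeapEntry

-- H ‼ a is H[a].  Addresses are 1-based; 0 is never a valid address.
infix 9 _‼_

_‼_ : Heap → Address → Maybe HeapEntry
H       ‼ zero        = nothing
[]      ‼ suc a       = nothing
(e ∷ H) ‼ suc zero    = just e
(e ∷ H) ‼ suc (suc a) = H ‼ suc a

-- lookup H a n is H[a,n].
lookup : Heap → Address → ℕ → Maybe Closure
lookup H a zero    = H ‼ a >>= λ (g , b) → just g
lookup H a (suc n) = H ‼ a >>= λ (g , b) → lookup H b n

State : Set
State = List Closure × List Closure × Heap

infix 4 _≻_

data _≻_ : State → State → Set where
  step-var : ∀ {n P a T V H g} → lookup H a n ≡ just g →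
    ((var n ∷ P , a) ∷ T , V , H) ≻ ((P , a) ∷ T , g ∷ V , H)
  step-lam : ∀ {P Q P′ a T V H} → φ P ≡ just (Q , P′) →
    ((lam ∷ P , a) ∷ T , V , H) ≻ ((P′ , a) ∷ T , (Q , a) ∷ V , H)
  step-app : ∀ {P Q a b g T V H} →
    ((app ∷ P , a) ∷ T , g ∷ (Q , b) ∷ V , H)
      ≻ ((Q , length H + 1) ∷ (P , a) ∷ T , V , H ++ [ (g , b) ])
  step-nil : ∀ {a T V H} →
    (([] , a) ∷ T , V , H) ≻ (T , V , H)

infix 4 _≻[_]_

data _≻[_]_ : State → ℕ → State → Set where
  done : ∀ {σ} → σ ≻[ 0 ] σ
  _◅_  : ∀ {k σ τ υ} → σ ≻ τ → τ ≻[ k ] υ → σ ≻[ suc k ] υ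

infixr 5 _◅_

initial : Term → State
initial s = [ (γ s , 0) ] , [] , []

sizeClosure : Closure → ℕ
sizeClosure (P , a) = sizeProgram P + a

sizeHeapEntry : HeapEntry → ℕ
sizeHeapEntry (g , b) = sizeClosure g + b

sizeState : State → ℕ
sizeState (T , V , H) =
  sum (map sizeClosure T) + sum (map sizeClosure V) + sum (map sizeHeapEntry H)

{-# OPTIONS --safe #-}

-- Every program in a reachable state is no larger than γ s, hence of size at
-- most 2|s|, and every address after k steps is at most k, since addresses
-- are heap positions and each step adds at most one heap entry.  Each step
-- also increases the total number of closures and heap entries by at most
-- one, so after k steps there are at most k + 1 of them, each of size at most
-- 2|s| + 2k.
module Submission where

open import Defs
open import Data.List.Base using (List; []; _∷_; _++_; [_]; length; map)
open import Data.List.Properties using (++-assoc; map-++; length-++)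
open import Data.List.Relation.Unary.All as All using (All; []; _∷_)
open import Data.List.Relation.Unary.All.Properties using (++⁺)
open import Data.Maybe.Base using (just; nothing)
open import Data.Nat.Base using (ℕ; zero; suc; _+_; _*_; _≤_; z≤n; s≤s)
open import Data.Nat.ListAction using (sum)
open import Data.Nat.ListAction.Properties using (sum-++)
open import Data.Nat.Properties
  using (module ≤-Reasoning; ≤-refl; ≤-reflexive; ≤-trans; n≤1+n; m≤m+n; m≤n+m; m≤n⇒m≤1+n;
         m≤n⇒m≤n+o; m+n≤o⇒m≤o; m+n≤o⇒n≤o; +-comm; +-suc; +-identityʳ; +-mono-≤; +-monoʳ-≤;
         *-suc; *-monoˡ-≤; *-monoʳ-≤; *-distribʳ-+)
open import Data.Nat.Tactic.RingSolver using (solve-∀)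
open import Data.Product.Base using (_×_; _,_; proj₁; proj₂)
open import Relation.Binary.PropositionalEquality
  using (_≡_; refl; sym; trans; cong; subst)

-- Dropping the leading 1 of `sizeProgram` makes the measure additive under `++`.
weight : Program → ℕ
weight P = sum (map sizeCommand P)

weight-++ : ∀ P Q → weight (P ++ Q) ≡ weight P + weight Q
weight-++ P Q = trans (cong sum (map-++ sizeCommand P Q)) (sum-++ (map sizeCommand P) _)

-- An abstraction uses the factor 2 in full: one constructor becomes the two commands `lam` and
-- `ret`. In an application the leading 1s of the two subprograms pay for `app` and for the leading
-- 1 of the whole.
sizeProgram-γ : ∀ s → sizeProgram (γ s) ≤ 2 * sizeTerm s
sizeProgram-γ (# n) = begin
  1 + (1 + n + 0)      ≤⟨ m≤m+n _ n ⟩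
  1 + (1 + n + 0) + n  ≡⟨ arith n ⟩
  2 * (1 + n)          ∎
  where
  open ≤-Reasoning
  arith : ∀ n → 1 + (1 + n + 0) + n ≡ 2 * (1 + n)
  arith = solve-∀
sizeProgram-γ (s · t) = begin
  1 + weight (γ s ++ γ t ++ [ app ])          ≡⟨ cong suc (weight-++ (γ s) _) ⟩
  1 + (weight (γ s) + weight (γ t ++ [ app ])) ≡⟨ cong (λ w → 1 + (weight (γ s) + w)) (weight-++ (γ t) _) ⟩
  1 + (weight (γ s) + (weight (γ t) + 1))     ≡⟨ arith₁ (weight (γ s)) (weight (γ t)) ⟩
  sizeProgram (γ s) + sizeProgram (γ t)       ≤⟨ +-mono-≤ (sizeProgram-γ s) (sizeProgram-γ t) ⟩
  2 * sizeTerm s + 2 * sizeTerm t             ≤⟨ m≤n+m _ 2 ⟩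
  2 + (2 * sizeTerm s + 2 * sizeTerm t)       ≡⟨ arith₂ (sizeTerm s) (sizeTerm t) ⟩
  2 * (1 + sizeTerm s + sizeTerm t)           ∎
  where
  open ≤-Reasoning
  arith₁ : ∀ x y → 1 + (x + (y + 1)) ≡ (1 + x) + (1 + y)
  arith₁ = solve-∀
  arith₂ : ∀ x y → 2 + (2 * x + 2 * y) ≡ 2 * (1 + x + y)
  arith₂ = solve-∀
sizeProgram-γ (ƛ s) = begin
  2 + weight (γ s ++ [ ret ])  ≡⟨ cong (2 +_) (weight-++ (γ s) _) ⟩
  2 + (weight (γ s) + 1)       ≡⟨ cong (2 +_) (+-comm (weight (γ s)) 1) ⟩
  2 + sizeProgram (γ s)        ≤⟨ +-monoʳ-≤ 2 (sizeProgram-γ s) ⟩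
  2 + 2 * sizeTerm s           ≡⟨ *-suc 2 (sizeTerm s) ⟨
  2 * (1 + sizeTerm s)         ∎
  where open ≤-Reasoning

sizeProgram-tail : ∀ c P → sizeProgram P ≤ sizeProgram (c ∷ P)
sizeProgram-tail c P = s≤s (m≤n+m (weight P) (sizeCommand c))

-- Each recursive call moves one command across the boundary between `Q` and `P`, leaving `Q ++ P`
-- unchanged up to associativity. Only the closing `ret` is lost.
weight-φ-acc : ∀ k Q P {Q′ P′} → φ-acc k Q P ≡ just (Q′ , P′) →
  weight Q′ + weight P′ ≤ weight (Q ++ P)
weight-φ-acc k Q (lam ∷ P) eq =
  subst (λ R → _ ≤ weight R) (++-assoc Q [ lam ] P) (weight-φ-acc (suc k) _ P eq)
weight-φ-acc k Q (var n ∷ P) eq =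
  subst (λ R → _ ≤ weight R) (++-assoc Q [ var n ] P) (weight-φ-acc k _ P eq)
weight-φ-acc k Q (app ∷ P) eq =
  subst (λ R → _ ≤ weight R) (++-assoc Q [ app ] P) (weight-φ-acc k _ P eq)
weight-φ-acc (suc k) Q (ret ∷ P) eq =
  subst (λ R → _ ≤ weight R) (++-assoc Q [ ret ] P) (weight-φ-acc k _ P eq)
weight-φ-acc zero Q (ret ∷ P) refl = begin
  weight Q + weight P          ≤⟨ +-monoʳ-≤ (weight Q) (n≤1+n _) ⟩
  weight Q + weight (ret ∷ P)  ≡⟨ weight-++ Q (ret ∷ P) ⟨
  weight (Q ++ ret ∷ P)        ∎
  where open ≤-Reasoning

sizeProgram-φ : ∀ P {Q P′} → φ P ≡ just (Q , P′) →
  sizeProgram Q ≤ sizeProgram P × sizeProgram P′ ≤ sizeProgram P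
sizeProgram-φ P {Q} {P′} eq =
  s≤s (m+n≤o⇒m≤o (weight Q) total) , s≤s (m+n≤o⇒n≤o (weight Q) total)
  where total = weight-φ-acc 0 [] P eq

-- The two bounds evolve differently along a run: `m` stays fixed, while `k` grows with the number
-- of steps.
record ClosureBound (m k : ℕ) (g : Closure) : Set where
  constructor _,_
  field
    program-≤ : sizeProgram (proj₁ g) ≤ m
    address-≤ : proj₂ g ≤ k

record EntryBound (m k : ℕ) (e : HeapEntry) : Set where
  constructor _,_
  field
    closure : ClosureBound m k (proj₁ e)
    link-≤  : proj₂ e ≤ k

ClosureBound-suc : ∀ {m k g} → ClosureBound m k g → ClosureBound m (suc k) g
ClosureBound-suc (p , a) = p , m≤n⇒m≤1+n a

EntryBound-suc : ∀ {m k e} → EntryBound m k e → EntryBound m (suc k) e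
EntryBound-suc (g , b) = ClosureBound-suc g , m≤n⇒m≤1+n b

All-‼ : ∀ {P : HeapEntry → Set} {H} a {e} → All P H → H ‼ a ≡ just e → P e
All-‼ (suc zero)    (p ∷ ps) refl = p
All-‼ (suc (suc a)) (p ∷ ps) eq   = All-‼ (suc a) ps eq

-- Whatever chain of links is followed, the result is the closure component of some heap entry.
All-lookup : ∀ {P : Closure → Set} {H} a n {g} →
  All (λ e → P (proj₁ e)) H → lookup H a n ≡ just g → P g
All-lookup {H = H} a zero ps eq with H ‼ a in at
All-lookup a zero ps refl | just (g , b) = All-‼ a ps at
All-lookup {H = H} a (suc n) ps eq with H ‼ a
... | just (g , b) = All-lookup b n ps eq

-- The bound `heap-≤` controls the next fresh address; `count-≤` alone would be off by one there, as
-- its `suc k` accounts for the single closure of the initial state.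
record Bounded (m k : ℕ) (σ : State) : Set where
  constructor bounded
  T = proj₁ σ
  V = proj₁ (proj₂ σ)
  H = proj₂ (proj₂ σ)
  field
    control : All (ClosureBound m k) T
    values  : All (ClosureBound m k) V
    heap    : All (EntryBound m k) H
    heap-≤  : length H ≤ k
    count-≤ : length T + length V + length H ≤ suc k

Bounded-suc : ∀ {m k σ} → Bounded m k σ → Bounded m (suc k) σ
Bounded-suc (bounded t v h l c) =
  bounded (All.map ClosureBound-suc t) (All.map ClosureBound-suc v)
          (All.map EntryBound-suc h) (m≤n⇒m≤1+n l) (m≤n⇒m≤1+n c)

Bounded-initial : ∀ s → Bounded (2 * sizeTerm s) 0 (initial s)
Bounded-initial s = bounded ((sizeProgram-γ s , z≤n) ∷ []) [] [] z≤n ≤-refl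

Bounded-step : ∀ {m k σ τ} → σ ≻ τ → Bounded m k σ → Bounded m (suc k) τ
Bounded-step {k = k} (step-var {n} {P} {a} {T} {V} {H} eq) β@(bounded _ _ _ _ c)
  with bounded ((p , q) ∷ t) v h l _ ← Bounded-suc β =
  bounded ((≤-trans (sizeProgram-tail (var n) P) p , q) ∷ t)
          (All-lookup a n (All.map EntryBound.closure h) eq ∷ v) h l
          -- The pushed value uses up the extra unit, so the count comes from the unweakened bound
          -- `c`; everything inherited uses the weakened ones.
          (subst (λ x → suc x + length H ≤ suc (suc k)) (sym (+-suc (length T) (length V))) (s≤s c))
Bounded-step {k = k} (step-lam {P} {Q} {P′} {a} {T} {V} {H} eq) β@(bounded _ _ _ _ c)
  with bounded ((p , q) ∷ t) v h l _ ← Bounded-suc β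
     | Q≤P , P′≤P ← sizeProgram-φ P eq =
  bounded ((≤-trans P′≤P P≤m , q) ∷ t) ((≤-trans Q≤P P≤m , q) ∷ v) h l
          (subst (λ x → suc x + length H ≤ suc (suc k)) (sym (+-suc (length T) (length V))) (s≤s c))
  where P≤m = ≤-trans (sizeProgram-tail lam P) (ClosureBound.program-≤ (All.head (Bounded.control β)))
Bounded-step {m} {k} (step-app {P} {Q} {a} {b} {g} {T} {V} {H}) β@(bounded _ _ _ l₀ c₀)
  with bounded ((p , q) ∷ t) (g≤ ∷ (Q≤m , b≤k) ∷ v) h _ c ← Bounded-suc β =
  bounded ((Q≤m , H+1≤) ∷ (≤-trans (sizeProgram-tail app P) p , q) ∷ t) v
          (++⁺ h ((g≤ , b≤k) ∷ []))
          (subst (_≤ suc k) (sym (length-++ H)) H+1≤)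
          (≤-trans (≤-reflexive count) c)
  where
  -- Used twice: as the bound on the fresh address and on the new heap length.
  H+1≤ : length H + 1 ≤ suc k
  H+1≤ = subst (_≤ suc k) (+-comm 1 (length H)) (s≤s l₀)
  arith : ∀ t v h → 2 + t + v + (h + 1) ≡ 1 + t + (2 + v) + h
  arith = solve-∀
  -- Two values are traded for one control closure and one heap entry, so the total does not change.
  count : 2 + length T + length V + length (H ++ [ (g , b) ])
        ≡ 1 + length T + (2 + length V) + length H
  count = trans (cong (2 + length T + length V +_) (length-++ H))
                (arith (length T) (length V) (length H))
Bounded-step step-nil β with bounded (_ ∷ t) v h l c ← Bounded-suc β =
  bounded t v h l (≤-trans (n≤1+n _) c)

-- The offset `j` is general because `_◅_` peels off the first step, so the induction restarts from
-- a later state.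
Bounded-steps : ∀ {m j k σ τ} → σ ≻[ k ] τ → Bounded m j σ → Bounded m (k + j) τ
Bounded-steps done β = β
Bounded-steps {m} {j} {τ = τ} (_◅_ {k} step steps) β =
  subst (λ i → Bounded m i τ) (+-suc k j) (Bounded-steps steps (Bounded-step step β))

sum-map-≤ : ∀ {A : Set} (f : A → ℕ) {n xs} →
  All (λ x → f x ≤ n) xs → sum (map f xs) ≤ length xs * n
sum-map-≤ f []       = z≤n
sum-map-≤ f (p ∷ ps) = +-mono-≤ p (sum-map-≤ f ps)

sizeState-≤ : ∀ {m k σ} → Bounded m k σ → sizeState σ ≤ suc k * (m + k + k)
sizeState-≤ {m} {k} {T , V , H} (bounded t v h _ c) = begin
  sizeState (T , V , H)
    ≤⟨ +-mono-≤ (+-mono-≤ (sum-map-≤ sizeClosure (All.map closure t))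
                          (sum-map-≤ sizeClosure (All.map closure v)))
                (sum-map-≤ sizeHeapEntry (All.map entry h)) ⟩
  length T * n + length V * n + length H * n
    ≡⟨ cong (_+ length H * n) (*-distribʳ-+ n (length T) (length V)) ⟨
  (length T + length V) * n + length H * n
    ≡⟨ *-distribʳ-+ n (length T + length V) (length H) ⟨
  (length T + length V + length H) * n
    ≤⟨ *-monoˡ-≤ n c ⟩
  suc k * n ∎
  where
  open ≤-Reasoning
  -- A heap entry holds one program and two addresses, its closure's own and its link; a plain
  -- closure has one address fewer.
  n = m + k + k
  closure : ∀ {g} → ClosureBound m k g → sizeClosure g ≤ n
  closure (p , a) = m≤n⇒m≤n+o k (+-mono-≤ p a)
  entry : ∀ {e} → EntryBound m k e → sizeHeapEntry e ≤ n
  entry ((p , a) , b) = +-mono-≤ (+-mono-≤ p a) b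

theorem17 : (s : Term) (k : ℕ) (σ : State) → initial s ≻[ k ] σ →
    sizeState σ ≤ (k + 1) * (3 * k + 4 * sizeTerm s)
theorem17 s k σ steps = begin
  sizeState σ
    ≤⟨ sizeState-≤ (subst (λ i → Bounded _ i σ) (+-identityʳ k)
                          (Bounded-steps steps (Bounded-initial s))) ⟩
  suc k * (2 * n + k + k)
    -- The invariant gives a sharper bound; `k + 2 * n` is the slack up to `3 * k + 4 * n`.
    ≤⟨ *-monoʳ-≤ (suc k) (m≤m+n _ (k + 2 * n)) ⟩
  suc k * (2 * n + k + k + (k + 2 * n))
    ≡⟨ arith k n ⟩
  (k + 1) * (3 * k + 4 * n) ∎
  where
  open ≤-Reasoning
  n = sizeTerm s
  arith : ∀ k n → suc k * (2 * n + k + k + (k + 2 * n)) ≡ (k + 1) * (3 * k + 4 * n)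
  arith = solve-∀
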